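{- For every directed temporal graph $\mathcal{G}=(V,E,\lambda)$, considered with non-strict temporal paths, there exists a proper directed temporal graph $\mathcal{H}$ on the same vertex set $V$ with $\mathcal{R}(\mathcal{G})=\mathcal{R}(\mathcal{H})$. In other words, every graph in the setting D \& non-strict has a reachability equivalent graph in the setting D \& proper.
   Context: A directed temporal graph is a triple $\mathcal{G}=(V,E,\lambda)$ with $V$ a finite vertex set, $E\subseteq\{(u,v)\in V\times V: u\ne v\}$ a set of arcs, and $\lambda$ assigns to each arc a nonempty finite set of time labels. $\mathcal{G}$ is proper if no two distinct arcs incident to a common vertex share a time label. A temporal path from $u$ to $v$ is a sequence $(e_1,t_1),\dots,(e_k,t_k)$, $k\ge1$, with $t_i\in\lambda(e_i)$, such that $e_1,\dots,e_k$ form a directed path from $u$ to $v$ (distinct vertices) and $t_1\le\dots\le t_k$. The reachability graph $\mathcal{R}(\mathcal{G})$ is the static directed graph on $V$ with an arc $(u,v)$, $u\ne v$, iff there is a temporal path from $u$ to $v$. -}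

module Defs where

open import Data.Nat using (ℕ; _≤_)
open import Data.Fin using (Fin)
open import Data.List using (List; []; _∷_)
open import Data.List.Membership.Propositional using (_∈_)
open import Data.List.Relation.Unary.Unique.Propositional using (Unique)
open import Data.Product using (Σ; _×_; _,_; ∃-syntax)
open import Relation.Binary.PropositionalEquality using (_≡_)
open import Relation.Nullary using (¬_)
open import Data.Sum using (_⊎_)
open import Data.Empty using (⊥)

-- A directed temporal graph on the vertex set V = Fin n.
-- labels u v is the finite set (as a list) of time labels of the arc (u,v);
-- the arc (u,v) belongs to E iff u ≢ v and labels u v is nonempty.
record TemporalGraph (n : ℕ) : Set where
  field
    labels : Fin n → Fin n → List ℕ
    noLoop : ∀ u → labels u u ≡ []
open TemporalGraph public

HasLabel : ∀ {n} → TemporalGraph n → Fin n → Fin n → ℕ → Set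
HasLabel G u v t = t ∈ labels G u v

IsArc : ∀ {n} → TemporalGraph n → Fin n → Fin n → Set
IsArc G u v = ¬ (u ≡ v) × ∃[ t ] HasLabel G u v t

ShareVertex : ∀ {n} → Fin n → Fin n → Fin n → Fin n → Set
ShareVertex u v u' v' =
  (u ≡ u' ⊎ u ≡ v') ⊎ (v ≡ u' ⊎ v ≡ v')

Proper : ∀ {n} → TemporalGraph n → Set
Proper {n} G =
  ∀ (u v u' v' : Fin n) (t : ℕ) →
  IsArc G u v → IsArc G u' v' →
  ¬ ((u , v) ≡ (u' , v')) →
  ShareVertex u v u' v' →
  HasLabel G u v t → HasLabel G u' v' t → ⊥

data TWalk {n} (G : TemporalGraph n) : ℕ → Fin n → Fin n → Set where
  one  : ∀ {u v t} → ¬ (u ≡ v) → HasLabel G u v t → TWalk G t u v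
  cons : ∀ {u w v t t'} → ¬ (u ≡ w) → HasLabel G u w t → t ≤ t' →
         TWalk G t' w v → TWalk G t u v

vertices : ∀ {n} {G : TemporalGraph n} {t u v} → TWalk G t u v → List (Fin n)
vertices {u = u} {v} (one _ _)        = u ∷ v ∷ []
vertices {u = u} (cons _ _ _ w)       = u ∷ vertices w

TemporalPath : ∀ {n} → TemporalGraph n → Fin n → Fin n → Set
TemporalPath G u v = Σ ℕ λ t → Σ (TWalk G t u v) λ w → Unique (vertices w)

Reach : ∀ {n} → TemporalGraph n → Fin n → Fin n → Set
Reach G u v = ¬ (u ≡ v) × TemporalPath G u v

SameReachability : ∀ {n} → TemporalGraph n → TemporalGraph n → Set
SameReachability {n} G H =
  ∀ (u v : Fin n) → (Reach G u v → Reach H u v) × (Reach H u v → Reach G u v)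

-- Let the closure H of G have, for every time t, an arc (u,v) at time t exactly when
-- v can be reached from u in G using arcs labelled t only. A temporal path of G splits into maximal runs of
-- equal labels, each of which becomes one arc of H; conversely every arc of H
-- unfolds into a run of equal labels in G, so G and H reach the same pairs.
-- H is made proper by stamping each of its labels with the arc carrying it:
-- the arc (u,v) at time t gets the label slot(u,v) + t·M with slot(u,v) < M,
-- so no two arcs of H share a label and L / M recovers the time.
module Submission where

open import Defs
open import Data.Nat using (ℕ; zero; suc; _+_; _*_; _≤_; _<_; _≤?_; z≤n; s≤s; NonZero)
open import Data.Nat.Properties using (≤-refl; ≤-trans; <⇒≤; <-≤-trans; ≰⇒>; ≮⇒≥; <⇒≱; m<n⇒m<1+n; m≤n⇒m<n∨m≡n)
open import Data.Nat.DivMod using (_/_; _%_; +-distrib-/-∣ʳ; m<n⇒m/n≡0; m*n/n≡m; [m+kn]%n≡m%n; m<n⇒m%n≡m; /-monoˡ-≤)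
open import Data.Nat.Divisibility using (n∣m*n)
open import Data.Fin as Fin using (Fin; toℕ; combine)
open import Data.Fin.Properties using (toℕ<n; toℕ-injective; combine-injective; pigeonhole; <⇒≢; any?)
open import Data.List using (List; []; _∷_; length; lookup; map; filter; concatMap; allFin)
open import Data.List.Properties using (filter-none)
open import Data.List.Membership.Propositional using (_∈_; lose)
open import Data.List.Membership.Propositional.Properties using (∈-lookup; ∈-map⁺; ∈-map⁻; ∈-filter⁺; ∈-filter⁻; ∈-concatMap⁺; ∈-allFin)
open import Data.List.Membership.DecPropositional Data.Nat._≟_ using () renaming (_∈?_ to _∈ℕ?_)
open import Data.List.Relation.Unary.Any using (here; there)
open import Data.List.Relation.Unary.All as All using (All; []; _∷_)
open import Data.List.Relation.Unary.All.Properties using (¬Any⇒All¬)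
open import Data.List.Relation.Unary.AllPairs using ([]; _∷_)
open import Data.List.Relation.Unary.Unique.Propositional using (Unique)
open import Data.Product using (Σ; ∃-syntax; _×_; _,_; proj₂)
open import Data.Sum using (_⊎_; inj₁; inj₂)
open import Relation.Nullary using (¬_; Dec; yes; no; contradiction)
open import Relation.Nullary.Decidable using (_×-dec_; _⊎-dec_; ¬?)
open import Relation.Binary.PropositionalEquality

Unique-lookup-injective : ∀ {A : Set} {xs : List A} → Unique xs →
                          ∀ i j → lookup xs i ≡ lookup xs j → i ≡ j
Unique-lookup-injective (_ ∷ _)   Fin.zero    Fin.zero    _  = refl
Unique-lookup-injective (x∉ ∷ _)  Fin.zero    (Fin.suc j) eq = contradiction eq (All.lookup x∉ (∈-lookup j))
Unique-lookup-injective (x∉ ∷ _)  (Fin.suc i) Fin.zero    eq = contradiction (sym eq) (All.lookup x∉ (∈-lookup i))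
Unique-lookup-injective (_ ∷ xs!) (Fin.suc i) (Fin.suc j) eq = cong Fin.suc (Unique-lookup-injective xs! i j eq)

Unique⇒length≤ : ∀ {n} {xs : List (Fin n)} → Unique xs → length xs ≤ n
Unique⇒length≤ {n} {xs} xs! with length xs ≤? n
... | yes ≤n = ≤n
... | no ≰n  = let (i , j , i<j , eq) = pigeonhole (≰⇒> ≰n) (lookup xs)
               in contradiction (Unique-lookup-injective xs! i j eq) (<⇒≢ i<j)

module Shortening {n} (G : TemporalGraph n) where
  open import Data.List.Membership.DecPropositional (Fin._≟_ {n}) using (_∈?_)

  private variable
    s t t' : ℕ
    u v w x : Fin n

  -- The disjunct u ≡ v stands for the empty path.
  PathAfter : ℕ → Fin n → Fin n → Set
  PathAfter t u v = u ≡ v ⊎ ∃[ t' ] t ≤ t' × Σ (TWalk G t' u v) λ p → Unique (vertices p)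

  PathAfter-weaken : s ≤ t → PathAfter t u v → PathAfter s u v
  PathAfter-weaken _   (inj₁ u≡v)               = inj₁ u≡v
  PathAfter-weaken s≤t (inj₂ (t' , t≤t' , p!)) = inj₂ (t' , ≤-trans s≤t t≤t' , p!)

  source∈vertices : (p : TWalk G t u v) → u ∈ vertices p
  source∈vertices (one _ _)      = here refl
  source∈vertices (cons _ _ _ _) = here refl

  suffix : (p : TWalk G t x v) → Unique (vertices p) → u ∈ vertices p → PathAfter t u v
  suffix p@(one _ _)      p! (here refl)         = inj₂ (_ , ≤-refl , p , p!)
  suffix (one _ _)        _  (there (here refl)) = inj₁ refl
  suffix p@(cons _ _ _ _) p! (here refl)         = inj₂ (_ , ≤-refl , p , p!)
  suffix (cons _ _ t≤t' p) (_ ∷ p!) (there u∈p)  = PathAfter-weaken t≤t' (suffix p p! u∈p)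

  arcPath : ¬ u ≡ v → HasLabel G u v t → PathAfter t u v
  arcPath u≢v uv = inj₂ (_ , ≤-refl , one u≢v uv , (u≢v ∷ []) ∷ [] ∷ [])

  -- If u already lies on the path, the suffix from u is a path that departs no earlier.
  prepend : ¬ u ≡ w → HasLabel G u w t → t ≤ t' → PathAfter t' w v → PathAfter t u v
  prepend u≢w uw _ (inj₁ refl) = arcPath u≢w uw
  prepend {u = u} u≢w uw t≤t' (inj₂ (_ , t'≤t'' , p , p!)) with u ∈? vertices p
  ... | yes u∈p = PathAfter-weaken (≤-trans t≤t' t'≤t'') (suffix p p! u∈p)
  ... | no  u∉p = inj₂ (_ , ≤-refl , cons u≢w uw (≤-trans t≤t' t'≤t'') p , ¬Any⇒All¬ _ u∉p ∷ p!)

  walk⇒pathAfter : TWalk G t u v → PathAfter t u v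
  walk⇒pathAfter (one u≢v uv)          = arcPath u≢v uv
  walk⇒pathAfter (cons u≢w uw t≤t' p) = prepend u≢w uw t≤t' (walk⇒pathAfter p)

  walk⇒path : ¬ u ≡ v → TWalk G t u v → TemporalPath G u v
  walk⇒path u≢v p with walk⇒pathAfter p
  ... | inj₁ u≡v            = contradiction u≡v u≢v
  ... | inj₂ (t' , _ , p!) = t' , p!

module Stamp (M : ℕ) .{{_ : NonZero M}} where

  private variable i L t : ℕ

  stamp : ℕ → ℕ → ℕ
  stamp t i = i + t * M

  stamp%M : ∀ t → i < M → stamp t i % M ≡ i
  stamp%M {i} t i<M = trans ([m+kn]%n≡m%n i t M) (m<n⇒m%n≡m i<M)

  stamp/M : ∀ t → i < M → stamp t i / M ≡ t
  stamp/M {i} t i<M = begin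
    (i + t * M) / M   ≡⟨ +-distrib-/-∣ʳ i (n∣m*n t) ⟩
    i / M + t * M / M ≡⟨ cong₂ _+_ (m<n⇒m/n≡0 i<M) (m*n/n≡m t M) ⟩
    t                 ∎
    where open ≡-Reasoning

  stamp≤ : i < M → t < L / M → stamp t i ≤ L
  stamp≤ {L = L} i<M t<L/M = ≮⇒≥ λ L<stamp →
    <⇒≱ t<L/M (subst (L / M ≤_) (stamp/M _ i<M) (/-monoˡ-≤ M (<⇒≤ L<stamp)))

module Closure {n} (G : TemporalGraph n) where

  open Shortening G using (source∈vertices)

  private variable
    k k' L t t' : ℕ
    u v w x : Fin n

  Arc : ℕ → Fin n → Fin n → Set
  Arc t u v = ¬ u ≡ v × HasLabel G u v t

  arc? : ∀ t u v → Dec (Arc t u v)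
  arc? t u v = ¬? (u Fin.≟ v) ×-dec (t ∈ℕ? labels G u v)

  FlatWalk : ℕ → ℕ → Fin n → Fin n → Set
  FlatWalk zero    t u v = Arc t u v
  FlatWalk (suc k) t u v = Arc t u v ⊎ ∃[ w ] Arc t u w × FlatWalk k t w v

  flatWalk? : ∀ k t u v → Dec (FlatWalk k t u v)
  flatWalk? zero    = arc?
  flatWalk? (suc k) t u v = arc? t u v ⊎-dec any? λ w → arc? t u w ×-dec flatWalk? k t w v

  arc⇒flatWalk : ∀ k → Arc t u v → FlatWalk k t u v
  arc⇒flatWalk zero    a = a
  arc⇒flatWalk (suc k) a = inj₁ a

  FlatWalk-mono : k ≤ k' → FlatWalk k t u v → FlatWalk k' t u v
  FlatWalk-mono {k' = k'} z≤n a      = arc⇒flatWalk k' a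
  FlatWalk-mono (s≤s _)    (inj₁ a)  = inj₁ a
  FlatWalk-mono (s≤s k≤k') (inj₂ (w , a , f)) = inj₂ (w , a , FlatWalk-mono k≤k' f)

  flatWalk⇒walk : FlatWalk k t u v → TWalk G t u v
  flatWalk⇒walk {zero}  (u≢v , uv)                  = one u≢v uv
  flatWalk⇒walk {suc k} (inj₁ (u≢v , uv))           = one u≢v uv
  flatWalk⇒walk {suc k} (inj₂ (_ , (u≢w , uw) , f)) = cons u≢w uw ≤-refl (flatWalk⇒walk f)

  flatWalk-++ : FlatWalk k t u v → t ≤ t' → TWalk G t' v x → TWalk G t u x
  flatWalk-++ {zero}  (u≢v , uv)                  t≤t' p = cons u≢v uv t≤t' p
  flatWalk-++ {suc k} (inj₁ (u≢v , uv))           t≤t' p = cons u≢v uv t≤t' p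
  flatWalk-++ {suc k} (inj₂ (_ , (u≢w , uw) , f)) t≤t' p = cons u≢w uw ≤-refl (flatWalk-++ f t≤t' p)

  departures : Fin n → List ℕ
  departures u = concatMap (labels G u) (allFin n)

  label∈departures : HasLabel G u w t → t ∈ departures u
  label∈departures {u = u} {w = w} uw = ∈-concatMap⁺ (labels G u) (lose (∈-allFin w) uw)

  flatWalk⇒departure : FlatWalk k t u v → t ∈ departures u
  flatWalk⇒departure {zero}  (_ , uv)                  = label∈departures uv
  flatWalk⇒departure {suc k} (inj₁ (_ , uv))           = label∈departures uv
  flatWalk⇒departure {suc k} (inj₂ (_ , (_ , uw) , _)) = label∈departures uw

  -- The bound n is harmless: a run of equal labels on a temporal path has fewer than n arcs.
  ReachableAt : ℕ → Fin n → Fin n → Set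
  ReachableAt t u v = ¬ u ≡ v × FlatWalk n t u v

  reachableAt? : ∀ t u v → Dec (ReachableAt t u v)
  reachableAt? t u v = ¬? (u Fin.≟ v) ×-dec flatWalk? n t u v

  -- Exceeds every slot; the suc only makes it NonZero.
  slots : ℕ
  slots = suc (n * n)

  open Stamp slots

  slot : Fin n → Fin n → ℕ
  slot u v = toℕ (combine u v)

  slot< : slot u v < slots
  slot< {u} {v} = m<n⇒m<1+n (toℕ<n (combine u v))

  label : ℕ → Fin n → Fin n → ℕ
  label t u v = stamp t (slot u v)

  time-label : ∀ t u v → label t u v / slots ≡ t
  time-label t u v = stamp/M t (slot< {u} {v})

  label-injective : ∀ t u v t' u' v' → label t u v ≡ label t' u' v' → (u , v) ≡ (u' , v')
  label-injective t u v t' u' v' eq =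
    let (u≡u' , v≡v') = combine-injective u v u' v' (toℕ-injective slot≡) in cong₂ _,_ u≡u' v≡v'
    where
    slot≡ : slot u v ≡ slot u' v'
    slot≡ = begin
      slot u v                ≡⟨ sym (stamp%M t slot<) ⟩
      label t u v % slots     ≡⟨ cong (_% slots) eq ⟩
      label t' u' v' % slots  ≡⟨ stamp%M t' slot< ⟩
      slot u' v'              ∎
      where open ≡-Reasoning

  closureLabels : Fin n → Fin n → List ℕ
  closureLabels u v = map (λ t → label t u v) (filter (λ t → reachableAt? t u v) (departures u))

  closure : TemporalGraph n
  closure = record
    { labels = closureLabels
    ; noLoop = λ u → cong (map _) (filter-none (λ t → reachableAt? t u u) {departures u}
                                     (All.universal (λ _ (u≢u , _) → u≢u refl) _))
    }

  closure-label⁺ : ReachableAt t u v → HasLabel closure u v (label t u v)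
  closure-label⁺ {u = u} {v} r@(_ , f) =
    ∈-map⁺ _ (∈-filter⁺ (λ t → reachableAt? t u v) (flatWalk⇒departure f) r)

  closure-label⁻ : HasLabel closure u v L → ∃[ t ] L ≡ label t u v × ReachableAt t u v
  closure-label⁻ {u} {v} L∈ with ∈-map⁻ _ L∈
  ... | t , t∈ , L≡ = t , L≡ , proj₂ (∈-filter⁻ (λ t → reachableAt? t u v) {xs = departures u} t∈)

  -- Labels of distinct arcs of the closure differ, whether or not the arcs meet.
  closure-proper : Proper closure
  closure-proper u v u' v' _ _ _ uv≢u'v' _ L∈ L∈'
    with closure-label⁻ L∈ | closure-label⁻ L∈'
  ... | t , refl , _ | t' , L≡ , _ = uv≢u'v' (label-injective t u v t' u' v' L≡)

  closure⇒walk : TWalk closure L u v → TWalk G (L / slots) u v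
  closure⇒walk {u = u} {v} (one _ uv) with closure-label⁻ uv
  ... | t , refl , (_ , f) = subst (λ s → TWalk G s u v) (sym (time-label t u v)) (flatWalk⇒walk f)
  closure⇒walk {u = u} {v} (cons {w = w} _ uw L≤L' p) with closure-label⁻ uw
  ... | t , refl , (_ , f) = subst (λ s → TWalk G s u v) (sym (time-label t u w))
          (flatWalk-++ f (subst (_≤ _) (time-label t u w) (/-monoˡ-≤ slots L≤L')) (closure⇒walk p))

  LaterClosureWalk : ℕ → Fin n → Fin n → Set
  LaterClosureWalk t y v = y ≡ v ⊎ ∃[ L ] t < L / slots × TWalk closure L y v

  -- The maximal initial run of arcs of p labelled t, which ends at end, and a
  -- closure walk for the remainder of p, departing strictly after t.
  record Segment {t x v} (p : TWalk G t x v) : Set where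
    field
      end   : Fin n
      size  : ℕ
      size< : size < length (vertices p)
      run   : FlatWalk size t x end
      x≢end : ¬ x ≡ end
      end∈p : end ∈ vertices p
      rest  : LaterClosureWalk t end v

  segment⇒closureWalk : (p : TWalk G t x v) → Unique (vertices p) → (s : Segment p) →
                        TWalk closure (label t x (Segment.end s)) x v
  segment⇒closureWalk {t} {x} {v} p p! s = extend rest
    where
    open Segment s
    arc : HasLabel closure x end (label t x end)
    arc = closure-label⁺ (x≢end , FlatWalk-mono (<⇒≤ (<-≤-trans size< (Unique⇒length≤ p!))) run)
    extend : LaterClosureWalk t end v → TWalk closure (label t x end) x v
    extend (inj₁ refl)             = one x≢end arc
    extend (inj₂ (_ , t<L , rest)) = cons x≢end arc (stamp≤ slot< t<L) rest

  segment : (p : TWalk G t x v) → Unique (vertices p) → Segment p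
  segment {v = v} (one x≢v xv) _ = record
    { end = v ; size = 0 ; size< = s≤s z≤n ; run = x≢v , xv
    ; x≢end = x≢v ; end∈p = there (here refl) ; rest = inj₁ refl }
  segment {t} (cons {w = z} x≢z xz t≤t' p) (x∉p ∷ p!) with m≤n⇒m<n∨m≡n t≤t'
  ... | inj₁ t<t' = record
    { end = z ; size = 0 ; size< = s≤s z≤n ; run = x≢z , xz
    ; x≢end = x≢z ; end∈p = there (source∈vertices p)
    ; rest = inj₂ (_ , subst (t <_) (sym (time-label _ z _)) t<t'
                     , segment⇒closureWalk p p! (segment p p!)) }
  ... | inj₂ refl = record
    { end = end ; size = suc size ; size< = s≤s size< ; run = inj₂ (z , (x≢z , xz) , run)
    ; x≢end = All.lookup x∉p end∈p ; end∈p = there end∈p ; rest = rest }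
    where open Segment (segment p p!)

  sameReachability : SameReachability G closure
  sameReachability u v =
      (λ (u≢v , _ , p , p!) → u≢v , Shortening.walk⇒path closure u≢v
                                      (segment⇒closureWalk p p! (segment p p!)))
    , (λ (u≢v , _ , p , _)  → u≢v , Shortening.walk⇒path G u≢v (closure⇒walk p))

theorem17 : ∀ (n : ℕ) (G : TemporalGraph n) →
    Σ (TemporalGraph n) (λ H → Proper H × SameReachability G H)
theorem17 n G = closure , closure-proper , sameReachability
  where open Closure G
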